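{- Assume the Continuum Hypothesis. Then $2^\omega$ does not have the Grinzing property.
   Context: A subset $W$ of $2^\omega$ has the Grinzing property if $W$ is uncountable and for every uncountable $Y\subseteq W$ there exist uncountable subsets $Y_\alpha$ of $Y$, for $\alpha\in\omega_1$, such that $\mathrm{cl}(Y_\alpha)\cap\mathrm{cl}(Y_\beta)=\varnothing$ whenever $\alpha\neq\beta$, where the closure is taken in $2^\omega$. -}

module Defs where

open import Data.Bool.Base using (Bool)
open import Data.Nat.Base using (ℕ; _<_)
open import Data.Product.Base using (Σ; Σ-syntax; ∃-syntax; _×_; _,_; proj₁; proj₂)
open import Data.Unit.Base using (tt)
open import Function.Bundles using (Injection; Bijection)
open import Induction.WellFounded using (WellFounded)
open import Level using (Level; _⊔_; 0ℓ; suc)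
open import Relation.Binary.Bundles using (Setoid; StrictTotalOrder)
open import Relation.Binary.Core using (Rel)
open import Relation.Binary.Definitions using (Reflexive; Symmetric; Transitive; _Respects_)
open import Relation.Binary.Morphism.Structures using (IsOrderIsomorphism)
open import Relation.Binary.PropositionalEquality using (_≡_; _≗_; _→-setoid_; setoid)
open import Relation.Nullary.Negation using (¬_)
open import Relation.Unary using (Pred; _∈_; _⊆_; _∩_; _≐_; Empty; U)
import Relation.Binary.Construct.On as On
import Relation.Binary.Morphism.Construct.Composition as Composition
import Relation.Binary.Morphism.Construct.Identity as Identity

private
  variable
    a ℓ : Level

Countable : Setoid a ℓ → Set (a ⊔ ℓ)
Countable S = Injection S (setoid ℕ)

-- Function extensionality is not assumed, so points of 2^ω are compared
-- pointwise and subsets are required to respect pointwise equality.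

Cantor : Set
Cantor = ℕ → Bool

cantor : Setoid 0ℓ 0ℓ
cantor = ℕ →-setoid Bool

record Subset : Set₁ where
  field
    ⟦_⟧      : Pred Cantor 0ℓ
    respects : ⟦_⟧ Respects _≗_

open Subset public

full : Subset
full = record { ⟦_⟧ = U ; respects = λ _ _ → tt }

subsetSetoid : Subset → Setoid 0ℓ 0ℓ
subsetSetoid A = On.setoid {B = Σ Cantor ⟦ A ⟧} cantor proj₁

Uncountable : Subset → Set
Uncountable A = ¬ Countable (subsetSetoid A)

-- The sets { y | y agrees with x below n } form a neighbourhood base at x
-- in the product topology.

AgreeBelow : ℕ → Rel Cantor 0ℓ
AgreeBelow n x y = ∀ i → i < n → x i ≡ y i

cl : Subset → Pred Cantor 0ℓ
cl A x = ∀ n → ∃[ y ] y ∈ ⟦ A ⟧ × AgreeBelow n x y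

-- ω₁ is the set of countable ordinals, an ordinal being a well-order
-- taken up to order isomorphism.

record CountableWellOrder : Set₁ where
  field
    strictTotalOrder : StrictTotalOrder 0ℓ 0ℓ 0ℓ

  open StrictTotalOrder strictTotalOrder public
    renaming (_<_ to _≺_)

  field
    wellFounded : WellFounded _≺_
    countable   : Countable Eq.setoid

infix 4 _≅_

_≅_ : Rel CountableWellOrder 0ℓ
α ≅ β = Σ (A.Carrier → B.Carrier) (IsOrderIsomorphism A._≈_ B._≈_ A._≺_ B._≺_)
  where
  module A = CountableWellOrder α
  module B = CountableWellOrder β

≅-refl : Reflexive _≅_
≅-refl {α} = _ , Identity.isOrderIsomorphism _≈_ _≺_ Eq.refl
  where open CountableWellOrder α

≅-trans : Transitive _≅_
≅-trans {k = γ} (_ , f) (_ , g) = _ , Composition.isOrderIsomorphism C.Eq.trans f g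
  where module C = CountableWellOrder γ

≅-sym : Symmetric _≅_
≅-sym {α} {β} (to , iso) = from , record
  { isOrderMonomorphism = record
    { isOrderHomomorphism = record
      { cong = λ {x} {y} x≈y → injective
          (B.Eq.trans (to-from x) (B.Eq.trans x≈y (B.Eq.sym (to-from y))))
      ; mono = λ {x} {y} x≺y → cancel
          (B.<-respˡ-≈ (B.Eq.sym (to-from x)) (B.<-respʳ-≈ (B.Eq.sym (to-from y)) x≺y))
      }
    ; injective = λ {x} {y} eq →
        B.Eq.trans (B.Eq.sym (to-from x)) (B.Eq.trans (cong eq) (to-from y))
    ; cancel = λ {x} {y} lt →
        B.<-respˡ-≈ (to-from x) (B.<-respʳ-≈ (to-from y) (mono lt))
    }
  ; surjective = λ x → to x , λ {z} z≈ →
      injective (B.Eq.trans (to-from z) z≈)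
  }
  where
  module A = CountableWellOrder α
  module B = CountableWellOrder β
  open IsOrderIsomorphism iso

  from : B.Carrier → A.Carrier
  from y = proj₁ (surjective y)

  to-from : ∀ y → to (from y) B.≈ y
  to-from y = proj₂ (surjective y) A.Eq.refl

ω₁ : Setoid (suc 0ℓ) 0ℓ
ω₁ = record
  { Carrier       = CountableWellOrder
  ; _≈_           = _≅_
  ; isEquivalence = record
    { refl  = λ {α} → ≅-refl {α}
    ; sym   = λ {α} {β} → ≅-sym {α} {β}
    ; trans = λ {α} {β} {γ} → ≅-trans {α} {β} {γ}
    }
  }

-- 2^ℵ₀ = ℵ₁
ContinuumHypothesis : Set₁
ContinuumHypothesis = Bijection cantor ω₁

-- The first condition on Z says that Z is well defined on ω₁, that is, on
-- isomorphism classes.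
Grinzing : Subset → Set₁
Grinzing W =
  Uncountable W ×
  (∀ (Y : Subset) → ⟦ Y ⟧ ⊆ ⟦ W ⟧ → Uncountable Y →
    Σ[ Z ∈ (CountableWellOrder → Subset) ]
      (∀ {α β : CountableWellOrder} → α ≅ β → ⟦ Z α ⟧ ≐ ⟦ Z β ⟧) ×
      (∀ α → ⟦ Z α ⟧ ⊆ ⟦ Y ⟧ × Uncountable (Z α)) ×
      (∀ α β → ¬ α ≅ β → Empty (cl (Z α) ∩ cl (Z β))))

{-# OPTIONS --safe #-}
module Submission where

-- The order on ω₁ makes 2^ω, under CH, a well-order ⋖ with countable initial
-- segments. Every closed nowhere dense set has a code β ∈ 2^ω, and by the Baire
-- category theorem some point avoids all those with a code β ⋖ α; the ⋖-least
-- such points, for α ∈ 2^ω, form a Luzin set: an uncountable set whose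
-- intersection with every nowhere dense set is countable. Hence the closure of
-- each uncountable subset of it contains a basic open set. There are only
-- countably many of these, so uncountably many such closures cannot be
-- pairwise disjoint.

open import Defs
open import Axiom.ExcludedMiddle using (ExcludedMiddle)
open import Data.Bool.Base using (Bool; true; false; not; if_then_else_)
open import Data.Bool.Properties using (not-¬)
open import Data.Empty using (⊥; ⊥-elim)
open import Data.Nat.Base using (ℕ; zero; suc; _<_; _≤_; _⊔_; z≤n; s≤s; z<s; s<s)
open import Data.Nat.Binary.Base using (ℕᵇ; 2[1+_]; 1+[2_]; toℕ; fromℕ)
  renaming (zero to 0ᵇ)
open import Data.Nat.Binary.Properties using (toℕ-injective; toℕ-fromℕ; fromℕ-toℕ)
open import Data.Nat.Induction using (<-wellFounded)
open import Data.Nat.Properties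
  using (≤-trans; ≤-refl; <-≤-trans; ≤-total; ≤-antisym; ≮⇒≥; n≤1+n; m≤m⊔n; m≤n⊔m;
         m≤n⇒m<n∨m≡n; <-irrefl; n<1+n; _<?_)
open import Data.Product.Base using (Σ; Σ-syntax; ∃; ∃₂; ∃-syntax; _×_; _,_; proj₁; proj₂)
open import Data.Sum.Base using (_⊎_; inj₁; inj₂)
open import Data.Unit.Base using (tt)
open import Function.Base using (_∘_)
open import Function.Bundles using (Injection; Bijection)
open import Induction.WellFounded using (WellFounded; Acc; acc)
open import Level using (0ℓ)
open import Relation.Binary.Core using (Rel)
open import Relation.Binary.Definitions using (tri<; tri≈; tri>)
open import Relation.Binary.Morphism.Structures using (IsOrderIsomorphism)
open import Relation.Binary.PropositionalEquality
  using (_≡_; _≗_; refl; sym; trans; cong; subst)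
open import Relation.Nullary.Decidable
  using (does; yes; no; decidable-stable; dec-true; dec-false)
open import Relation.Nullary.Negation using (¬_; contradiction)
open import Relation.Unary using (Pred; _∈_; _∉_; _⊆_; _∩_; Empty; U)
import Relation.Binary.Construct.On as On

open CountableWellOrder using (Carrier)

-- Minimal elements and pointwise equality

Minimal : {A : Set} → Rel A 0ℓ → Pred A 0ℓ → Pred A 0ℓ
Minimal _≺_ P x = P x × (∀ {y} → P y → ¬ y ≺ x)

≗-sym : {x y : Cantor} → x ≗ y → y ≗ x
≗-sym x≗y i = sym (x≗y i)

≗-trans : {x y z : Cantor} → x ≗ y → y ≗ z → x ≗ z
≗-trans x≗y y≗z i = trans (x≗y i) (y≗z i)

-- Enumerations

Enumerable : Pred Cantor 0ℓ → Set
Enumerable P = Σ[ e ∈ (ℕ → Cantor) ] (∀ x → P x → ∃[ n ] e n ≗ x)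

-- Cantor's diagonal sequence differs from `e n` at place `n`.
¬enumerable-U : ¬ Enumerable U
¬enumerable-U (e , onto) with onto (λ n → not (e n n)) tt
... | n , eq = not-¬ refl (eq n)

-- The leading digits `2[1+_]` are counted by the first component; what follows the first `1+[2_]`
-- is the second, with default `0` if there is none.
unpairᵇ : ℕᵇ → ℕ × ℕ
unpairᵇ 0ᵇ       = 0 , 0
unpairᵇ 2[1+ x ] = suc (proj₁ (unpairᵇ x)) , proj₂ (unpairᵇ x)
unpairᵇ 1+[2 x ] = 0 , toℕ x

unpairᵇ-surjective : ∀ m n → ∃[ x ] unpairᵇ x ≡ (m , n)
unpairᵇ-surjective zero    n = 1+[2 fromℕ n ] , cong (0 ,_) (toℕ-fromℕ n)
unpairᵇ-surjective (suc m) n with unpairᵇ-surjective m n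
... | x , eq = 2[1+ x ] , cong (λ p → suc (proj₁ p) , proj₂ p) eq

⋃-enumerable : {P : ℕ → Pred Cantor 0ℓ} → (∀ n → Enumerable (P n)) →
               Enumerable (λ x → ∃[ n ] P n x)
⋃-enumerable {P} enum = e , onto
  where
  at : ℕ × ℕ → Cantor
  at (m , n) = proj₁ (enum m) n

  e : ℕ → Cantor
  e = at ∘ unpairᵇ ∘ fromℕ

  onto : ∀ x → (∃[ n ] P n x) → ∃[ k ] e k ≗ x
  onto x (m , p) with proj₂ (enum m) x p
  ... | n , eq with unpairᵇ-surjective m n
  ... | b , b≡ = toℕ b , λ i →
    trans (cong (λ q → at q i) (trans (cong unpairᵇ (fromℕ-toℕ b)) b≡)) (eq i)

-- Comparison of countable well-orders

-- The range need not be an initial segment, which makes composition immediate; classically this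
-- still compares order types, so `_⊏_` is the strict order of ordinals.
EmbedsBelow : (A B : CountableWellOrder) → Carrier B → Set
EmbedsBelow A B b =
  Σ[ f ∈ (A.Carrier → B.Carrier) ]
    (∀ {x y} → x A.≺ y → f x B.≺ f y) × (∀ x → f x B.≺ b)
  where
  module A = CountableWellOrder A
  module B = CountableWellOrder B

infix 4 _⊏_

_⊏_ : CountableWellOrder → CountableWellOrder → Set
A ⊏ B = ∃ (EmbedsBelow A B)

embedsBelow-trans : ∀ {A B C a c} → EmbedsBelow A B a → EmbedsBelow B C c →
                    ∃[ c′ ] CountableWellOrder._≺_ C c′ c × EmbedsBelow A C c′
embedsBelow-trans {a = a} (f , f-mono , f<a) (g , g-mono , g<c) =
  g a , g<c a , g ∘ f , g-mono ∘ f-mono , g-mono ∘ f<a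

⊏-respʳ-≅ : ∀ {A B C} → B ≅ C → A ⊏ B → A ⊏ C
⊏-respʳ-≅ (to , iso) (b , f , f-mono , f<b) =
  to b , to ∘ f , mono ∘ f-mono , mono ∘ f<b
  where open IsOrderIsomorphism iso

-- All orders in a chain descending from `B` embed into `B` itself, with bounds that strictly
-- decrease there.
⊏-wellFounded : WellFounded _⊏_
⊏-wellFounded B = acc λ (b , A↪B) → below (B.wellFounded b) A↪B
  where
  module B = CountableWellOrder B

  below : ∀ {A b} → Acc B._≺_ b → EmbedsBelow A B b → Acc _⊏_ A
  below {A} (acc rs) A↪B = acc λ {A′} (a , A′↪A) →
    let b′ , b′≺b , A′↪B = embedsBelow-trans {A′} {A} {B} A′↪A A↪B
    in below (rs b′≺b) A′↪B

module Comparison (A B : CountableWellOrder) where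
  private
    module A = CountableWellOrder A
    module B = CountableWellOrder B

  infix 4 _∼_

  -- Bisimilarity: the segments below `a` and `b` are isomorphic. The relation is thus the largest
  -- isomorphism between initial segments of `A` and `B`.
  data _∼_ (a : A.Carrier) (b : B.Carrier) : Set where
    sim : (∀ {a′} → a′ A.≺ a → ∃[ b′ ] b′ B.≺ b × a′ ∼ b′) →
          (∀ {b′} → b′ B.≺ b → ∃[ a′ ] a′ A.≺ a × a′ ∼ b′) →
          a ∼ b

  forth : ∀ {a a′ b} → a ∼ b → a′ A.≺ a → ∃[ b′ ] b′ B.≺ b × a′ ∼ b′
  forth (sim f _) = f

  back : ∀ {a b b′} → a ∼ b → b′ B.≺ b → ∃[ a′ ] a′ A.≺ a × a′ ∼ b′
  back (sim _ g) = g

  ∼-respˡ : ∀ {a a′ b} → a A.≈ a′ → a ∼ b → a′ ∼ b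
  ∼-respˡ a≈a′ (sim f g) = sim
    (λ lt → f (A.<-respʳ-≈ (A.Eq.sym a≈a′) lt))
    (λ lt → let x , x≺a , s = g lt in x , A.<-respʳ-≈ a≈a′ x≺a , s)

  ∼-respʳ : ∀ {a b b′} → b B.≈ b′ → a ∼ b → a ∼ b′
  ∼-respʳ b≈b′ (sim f g) = sim
    (λ lt → let y , y≺b , s = f lt in y , B.<-respʳ-≈ b≈b′ y≺b , s)
    (λ lt → g (B.<-respʳ-≈ (B.Eq.sym b≈b′) lt))

  -- Going back from `b′` and forth again recreates the hypotheses at `a₁`, strictly below `a`.
  ∼-functional-≺ : ∀ {a b b′} → Acc A._≺_ a → a ∼ b → a ∼ b′ → ¬ b′ B.≺ b
  ∼-functional-≺ (acc rs) a∼b a∼b′ b′≺b =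
    let a₁ , a₁≺a  , a₁∼b′ = back a∼b b′≺b
        b₁ , b₁≺b′ , a₁∼b₁ = forth a∼b′ a₁≺a
    in ∼-functional-≺ (rs a₁≺a) a₁∼b′ a₁∼b₁ b₁≺b′

  ∼-functional : ∀ {a b b′} → a ∼ b → a ∼ b′ → b B.≈ b′
  ∼-functional {a} {b} {b′} s s′ with B.compare b b′
  ... | tri< lt _ _ = contradiction lt (∼-functional-≺ (A.wellFounded a) s′ s)
  ... | tri≈ _ eq _ = eq
  ... | tri> _ _ gt = contradiction gt (∼-functional-≺ (A.wellFounded a) s s′)

  ∼-injective-≺ : ∀ {a a′ b} → a ∼ b → a′ ∼ b → ¬ a′ A.≺ a
  ∼-injective-≺ {a′ = a′} a∼b a′∼b a′≺a =
    let b′ , b′≺b , a′∼b′ = forth a∼b a′≺a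
    in ∼-functional-≺ (A.wellFounded a′) a′∼b a′∼b′ b′≺b

  ∼-injective : ∀ {a a′ b} → a ∼ b → a′ ∼ b → a A.≈ a′
  ∼-injective {a} {a′} s s′ with A.compare a a′
  ... | tri< lt _ _ = contradiction lt (∼-injective-≺ s′ s)
  ... | tri≈ _ eq _ = eq
  ... | tri> _ _ gt = contradiction gt (∼-injective-≺ s s′)

  ∼-mono : ∀ {a b c d} → a ∼ b → c ∼ d → a A.≺ c → b B.≺ d
  ∼-mono a∼b c∼d a≺c =
    let d′ , d′≺d , a∼d′ = forth c∼d a≺c
    in B.<-respˡ-≈ (∼-functional a∼d′ a∼b) d′≺d

  ∼-cancel : ∀ {a b c d} → a ∼ b → c ∼ d → b B.≺ d → a A.≺ c
  ∼-cancel a∼b c∼d b≺d =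
    let c′ , c′≺c , c′∼b = back c∼d b≺d
    in A.<-respˡ-≈ (∼-injective c′∼b a∼b) c′≺c

  -- By `forth` the domain of `_∼_` is downward closed, so it lies below any element outside it.
  domain-below : ∀ {a b a₀} → a ∼ b → ¬ ∃ (a₀ ∼_) → a A.≺ a₀
  domain-below {a} {b} {a₀} a∼b a₀∉ with A.compare a a₀
  ... | tri< lt _ _ = lt
  ... | tri≈ _ eq _ = contradiction (b , ∼-respˡ eq a∼b) a₀∉
  ... | tri> _ _ gt = let b′ , _ , s = forth a∼b gt in contradiction (b′ , s) a₀∉

  range-below : ∀ {a b b₀} → a ∼ b → ¬ ∃ (_∼ b₀) → b B.≺ b₀
  range-below {a} {b} {b₀} a∼b b₀∉ with B.compare b b₀
  ... | tri< lt _ _ = lt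
  ... | tri≈ _ eq _ = contradiction (a , ∼-respʳ eq a∼b) b₀∉
  ... | tri> _ _ gt = let a′ , _ , s = back a∼b gt in contradiction (a′ , s) b₀∉

  total⇒⊏ : (∀ a → ∃ (a ∼_)) → ∀ {b₀} → ¬ ∃ (_∼ b₀) → A ⊏ B
  total⇒⊏ total {b₀} b₀∉ =
    b₀ , proj₁ ∘ total ,
    (λ {x} {y} → ∼-mono (proj₂ (total x)) (proj₂ (total y))) ,
    (λ x → range-below (proj₂ (total x)) b₀∉)

  onto⇒⊐ : (∀ b → ∃ (_∼ b)) → ∀ {a₀} → ¬ ∃ (a₀ ∼_) → B ⊏ A
  onto⇒⊐ onto {a₀} a₀∉ =
    a₀ , proj₁ ∘ onto ,
    (λ {x} {y} → ∼-cancel (proj₂ (onto x)) (proj₂ (onto y))) ,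
    (λ x → domain-below (proj₂ (onto x)) a₀∉)

  total∧onto⇒≅ : (∀ a → ∃ (a ∼_)) → (∀ b → ∃ (_∼ b)) → A ≅ B
  total∧onto⇒≅ total onto = to , record
    { isOrderMonomorphism = record
      { isOrderHomomorphism = record
        { cong = λ {x} {y} x≈y → ∼-functional (∼-respˡ x≈y (to-∼ x)) (to-∼ y)
        ; mono = λ {x} {y} → ∼-mono (to-∼ x) (to-∼ y)
        }
      ; injective = λ {x} {y} eq → ∼-injective (∼-respʳ eq (to-∼ x)) (to-∼ y)
      ; cancel = λ {x} {y} → ∼-cancel (to-∼ x) (to-∼ y)
      }
    ; surjective = λ b → let a , a∼b = onto b in
        a , λ {z} z≈a → ∼-functional (∼-respˡ z≈a (to-∼ z)) a∼b
    }
    where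
    to : A.Carrier → B.Carrier
    to = proj₁ ∘ total

    to-∼ : ∀ a → a ∼ to a
    to-∼ = proj₂ ∘ total

-- Topology of 2^ω

Open : Pred Cantor 0ℓ → Set
Open P = ∀ {x} → P x → ∃[ n ] (∀ y → AgreeBelow n x y → P y)

Dense : Pred Cantor 0ℓ → Set
Dense P = ∀ x n → ∃[ y ] AgreeBelow n x y × P y

Dense-mono : {P Q : Pred Cantor 0ℓ} → P ⊆ Q → Dense P → Dense Q
Dense-mono P⊆Q dense x n = let y , x≈y , p = dense x n in y , x≈y , P⊆Q p

-- Nested cylinders: each new centre is taken in `P k` inside the old cylinder, and the new radius
-- keeps the new cylinder within both.
baire : (P : ℕ → Pred Cantor 0ℓ) → (∀ n → Open (P n)) → (∀ n → Dense (P n)) →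
        ∃[ x ] (∀ n → P n x)
baire P open′ dense = limit , limit∈
  where
  record Stage : Set where
    constructor _,_
    field
      point  : Cantor
      radius : ℕ

  open Stage

  module Next (k : ℕ) (s : Stage) where
    next : Cantor
    next = proj₁ (dense k (point s) (radius s))

    agree : AgreeBelow (radius s) (point s) next
    agree = proj₁ (proj₂ (dense k (point s) (radius s)))

    ball : ∃[ n ] (∀ y → AgreeBelow n next y → P k y)
    ball = open′ k (proj₂ (proj₂ (dense k (point s) (radius s))))

    stage : Stage
    -- The `suc` forces the radius at stage `k` to be at least `k`, so digit `i` is settled by stage
    -- `suc i`.
    stage = next , suc (radius s ⊔ proj₁ ball)

  stage : ℕ → Stage
  stage zero    = (λ _ → false) , 0
  stage (suc k) = Next.stage k (stage k)

  radius-step : ∀ k → radius (stage k) < radius (stage (suc k))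
  radius-step k = s≤s (m≤m⊔n _ _)

  k≤radius : ∀ k → k ≤ radius (stage k)
  k≤radius zero    = z≤n
  k≤radius (suc k) = ≤-trans (s≤s (k≤radius k)) (radius-step k)

  coherent : ∀ {j k} → j ≤ k →
             AgreeBelow (radius (stage j)) (point (stage j)) (point (stage k)) ×
             radius (stage j) ≤ radius (stage k)
  coherent {k = zero}  z≤n = (λ _ _ → refl) , ≤-refl
  coherent {k = suc k} j≤k with m≤n⇒m<n∨m≡n j≤k
  ... | inj₂ refl       = (λ _ _ → refl) , ≤-refl
  ... | inj₁ (s≤s j≤k′) = let agree , r≤ = coherent j≤k′ in
    (λ i i<r → trans (agree i i<r) (Next.agree k (stage k) i (<-≤-trans i<r r≤))) ,
    ≤-trans r≤ (≤-trans (n≤1+n _) (radius-step k))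

  limit : Cantor
  limit i = point (stage (suc i)) i

  limit-agree : ∀ k → AgreeBelow (radius (stage k)) (point (stage k)) limit
  -- Whichever of the stages `k` and `suc i` comes first already fixes digit `i`.
  limit-agree k i i<r with ≤-total k (suc i)
  ... | inj₁ k≤ = proj₁ (coherent k≤) i i<r
  ... | inj₂ ≤k = sym (proj₁ (coherent ≤k) i (k≤radius (suc i)))

  limit∈ : ∀ n → P n limit
  limit∈ n = proj₂ (Next.ball n (stage n)) limit λ i i<m →
    limit-agree (suc n) i (≤-trans i<m (≤-trans (m≤n⊔m (radius (stage n)) _) (n≤1+n _)))

-- Codes of finite binary words and of open sets

bit : Bool → ℕᵇ → ℕᵇ
bit true  = 2[1+_]
bit false = 1+[2_]

-- Bits become the digits 1 and 2 of bijective base two; neither is zero, so words of different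
-- lengths have different codes.
prefixᵇ : Cantor → ℕ → ℕᵇ
prefixᵇ x zero    = 0ᵇ
prefixᵇ x (suc n) = bit (x 0) (prefixᵇ (x ∘ suc) n)

bit≢0 : ∀ b {u} → ¬ bit b u ≡ 0ᵇ
bit≢0 true  ()
bit≢0 false ()

bit-injective : ∀ b c {u v} → bit b u ≡ bit c v → b ≡ c × u ≡ v
bit-injective true  true  refl = refl , refl
bit-injective false false refl = refl , refl

prefixᵇ-cong : ∀ n {x y} → AgreeBelow n x y → prefixᵇ x n ≡ prefixᵇ y n
prefixᵇ-cong zero    agree = refl
prefixᵇ-cong (suc n) {x} {y} agree
  rewrite agree 0 z<s | prefixᵇ-cong n {x ∘ suc} {y ∘ suc} (λ i i<n → agree (suc i) (s<s i<n))
  = refl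

prefixᵇ-injective : ∀ m n {x y} → prefixᵇ x m ≡ prefixᵇ y n → m ≡ n × AgreeBelow m x y
prefixᵇ-injective zero    zero        eq = refl , λ _ ()
prefixᵇ-injective zero    (suc n) {y = y} eq = contradiction (sym eq) (bit≢0 (y 0))
prefixᵇ-injective (suc m) zero    {x} eq = contradiction eq (bit≢0 (x 0))
prefixᵇ-injective (suc m) (suc n) {x} {y} eq
  with x₀≡y₀ , eq′ ← bit-injective (x 0) (y 0) eq
  with refl , agree ← prefixᵇ-injective m n eq′
  = refl , λ { zero _ → x₀≡y₀ ; (suc i) (s≤s i<m) → agree i i<m }

prefix : Cantor → ℕ → ℕ
prefix x n = toℕ (prefixᵇ x n)

prefix-cong : ∀ n {x y} → AgreeBelow n x y → prefix x n ≡ prefix y n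
prefix-cong n agree = cong toℕ (prefixᵇ-cong n agree)

prefix-injective : ∀ m n {x y} → prefix x m ≡ prefix y n → m ≡ n × AgreeBelow m x y
prefix-injective m n eq = prefixᵇ-injective m n (toℕ-injective eq)

-- `z` is the characteristic function of a set of codes of words, and the union of their cylinders
-- is taken; classically every open set arises so.
openSet : Cantor → Pred Cantor 0ℓ
openSet z x = ∃[ n ] z (prefix x n) ≡ true

openSet-open : ∀ z → Open (openSet z)
openSet-open z (n , eq) = n , λ y agree →
  n , trans (cong z (sym (prefix-cong n agree))) eq

openSet-cong : ∀ {z z′} → z ≗ z′ → openSet z ⊆ openSet z′
openSet-cong z≗z′ (n , eq) = n , trans (sym (z≗z′ _)) eq

-- Every z, whether or not it codes a dense set, contributes a dense open set.
denseOpenSet : Cantor → Pred Cantor 0ℓ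
denseOpenSet z x = Dense (openSet z) → openSet z x

denseOpenSet-cong : ∀ {z z′} → z ≗ z′ → denseOpenSet z ⊆ denseOpenSet z′
denseOpenSet-cong {z} {z′} z≗z′ x∈ dense =
  openSet-cong z≗z′ (x∈ (Dense-mono (openSet-cong (≗-sym z≗z′)) dense))

-- Nowhere dense sets

NowhereDense : Subset → Set
NowhereDense A = Dense (λ x → ¬ cl A x)

singleton : Cantor → Subset
singleton p = record { ⟦_⟧ = p ≗_ ; respects = λ x≗y p≗x → ≗-trans p≗x x≗y }

singleton-nowhereDense : ∀ p → NowhereDense (singleton p)
singleton-nowhereDense p x n = y , agree , y∉cl
  where
  y : Cantor
  -- Copying `x` below `n` keeps `y` in the given cylinder; flipping `p` from `n` on separates it
  -- from `p`.
  y i = if does (i <? n) then x i else not (p i)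

  agree : AgreeBelow n x y
  agree i i<n rewrite dec-true (i <? n) i<n = refl

  yn≡ : y n ≡ not (p n)
  yn≡ rewrite dec-false (n <? n) (<-irrefl refl) = refl

  y∉cl : ¬ cl (singleton p) y
  y∉cl y∈cl with y∈cl (suc n)
  ... | q , p≗q , y≈q = not-¬ (trans (y≈q n (n<1+n n)) (sym (p≗q n))) yn≡

-- Consequences of excluded middle

module Classical (em : ExcludedMiddle 0ℓ) where

  dne : {P : Set} → ¬ ¬ P → P
  dne = decidable-stable em

  ¬∃¬⇒∀ : {A : Set} {P : Pred A 0ℓ} → ¬ ∃ (λ x → ¬ P x) → ∀ x → P x
  ¬∃¬⇒∀ ¬∃¬ x = dne λ ¬p → ¬∃¬ (x , ¬p)

  minimal : {A : Set} {_≺_ : Rel A 0ℓ} {P : Pred A 0ℓ} →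
            WellFounded _≺_ → ∃ P → ∃ (Minimal _≺_ P)
  minimal {_≺_ = _≺_} {P} wf (x , p) = go (wf x) p
    where
    go : ∀ {x} → Acc _≺_ x → P x → ∃ (Minimal _≺_ P)
    go {x} (acc rs) p with em {∃[ y ] P y × y ≺ x}
    ... | yes (y , q , y≺x) = go (rs y≺x) q
    ... | no  ∄             = x , p , λ {y} q y≺x → ∄ (y , q , y≺x)

  injection⇒enumerable : {P : Pred Cantor 0ℓ} (f : ∀ x → P x → ℕ) →
    (∀ {x y} (p : P x) (q : P y) → f x p ≡ f y q → x ≗ y) → Enumerable P
  injection⇒enumerable {P} f injective = e , onto
    where
    e : ℕ → Cantor
    e n with em {∃ λ x → Σ[ p ∈ P x ] f x p ≡ n}
    ... | yes (x , _) = x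
    -- A default for numbers outside the range of `f`.
    ... | no  _       = λ _ → false

    onto : ∀ x → P x → ∃[ n ] e n ≗ x
    onto x p = f x p , eq
      where
      eq : e (f x p) ≗ x
      eq with em {∃ λ y → Σ[ q ∈ P y ] f y q ≡ f x p}
      ... | yes (y , q , fy≡fx) = injective q p fy≡fx
      ... | no  ∄               = contradiction (x , p , refl) ∄

  countable⇒enumerable : ∀ A → Countable (subsetSetoid A) → Enumerable ⟦ A ⟧
  countable⇒enumerable A inj =
    injection⇒enumerable (λ x p → to (x , p)) (λ p q → injective)
    where open Injection inj

  -- The least index is taken because an Injection must respect ≗.
  enumerable⇒countable : ∀ A → Enumerable ⟦ A ⟧ → Countable (subsetSetoid A)
  enumerable⇒countable A (e , onto) = record
    { to        = proj₁ ∘ index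
    ; cong      = λ {x} {y} x≗y → ≤-antisym
        (below x y x≗y) (below y x (≗-sym x≗y))
    ; injective = λ {x} {y} eq → ≗-trans
        (≗-sym (proj₁ (proj₂ (index x))))
        (subst (λ n → e n ≗ proj₁ y) (sym eq) (proj₁ (proj₂ (index y))))
    }
    where
    index : (x : Σ Cantor ⟦ A ⟧) → ∃ (Minimal _<_ (λ n → e n ≗ proj₁ x))
    index (x , p) = minimal <-wellFounded (onto x p)

    below : ∀ x y → proj₁ x ≗ proj₁ y → proj₁ (index x) ≤ proj₁ (index y)
    below x y x≗y = ≮⇒≥ (proj₂ (proj₂ (index x))
      (≗-trans (proj₁ (proj₂ (index y))) (≗-sym x≗y)))

  -- `_∼_` matches initial segments of `A` and `B`. The case to exclude is that it leaves out
  -- elements on both sides.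
  ⊏-connex : ∀ A B → A ⊏ B ⊎ A ≅ B ⊎ B ⊏ A
  ⊏-connex A B with em {∃ λ a → ¬ ∃ (a ∼_)} | em {∃ λ b → ¬ ∃ (_∼ b)}
    where open Comparison A B
  ... | no ∄a  | no ∄b        = inj₂ (inj₁ (total∧onto⇒≅ (¬∃¬⇒∀ ∄a) (¬∃¬⇒∀ ∄b)))
    where open Comparison A B
  ... | no ∄a  | yes (_ , b∉) = inj₁ (total⇒⊏ (¬∃¬⇒∀ ∄a) b∉)
    where open Comparison A B
  ... | yes (_ , a∉) | no ∄b  = inj₂ (inj₂ (onto⇒⊐ (¬∃¬⇒∀ ∄b) a∉))
    where open Comparison A B
  ... | yes ∃a | yes ∃b       =
    let a₀ , a₀∉ , a₀-min = minimal A.wellFounded ∃a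
        b₀ , b₀∉ , b₀-min = minimal B.wellFounded ∃b
    in contradiction
      -- The least unmatched elements would match: by minimality everything below one has a partner,
      -- and that partner lies below the other.
      (b₀ , sim
        (λ a≺a₀ → let b , s = dne (λ a∉ → a₀-min a∉ a≺a₀) in b , range-below s b₀∉ , s)
        (λ b≺b₀ → let a , s = dne (λ b∉ → b₀-min b∉ b≺b₀) in a , domain-below s a₀∉ , s))
      a₀∉
    where
    open Comparison A B
    module A = CountableWellOrder A
    module B = CountableWellOrder B

  -- If `z` does not code a dense set, the implication is vacuous and defines the whole space.
  denseOpenSet-open : ∀ z → Open (denseOpenSet z)
  denseOpenSet-open z x∈ with em {Dense (openSet z)}
  ... | yes dense  = let n , ball = openSet-open z (x∈ dense) in n , λ y agree _ → ball y agree
  ... | no  ¬dense = 0 , λ _ _ dense → contradiction dense ¬dense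

  denseOpenSet-dense : ∀ z → Dense (denseOpenSet z)
  denseOpenSet-dense z with em {Dense (openSet z)}
  ... | yes dense  = Dense-mono (λ x∈ _ → x∈) dense
  ... | no  ¬dense = λ x n → x , (λ _ _ → refl) , λ dense → contradiction dense ¬dense

  Meets : Subset → Pred ℕ 0ℓ
  Meets A k = ∃₂ λ y n → y ∈ ⟦ A ⟧ × prefix y n ≡ k

  -- A code of the complement of the closure: all words whose cylinder misses `A`.
  exterior : Subset → Cantor
  exterior A k = not (does (em {Meets A k}))

  exterior-disjoint : ∀ A {x} → x ∈ ⟦ A ⟧ → x ∉ openSet (exterior A)
  exterior-disjoint A {x} x∈A (n , eq) with em {Meets A (prefix x n)}
  exterior-disjoint A {x} x∈A (n , ()) | yes _
  exterior-disjoint A {x} x∈A (n , eq) | no ¬meets = ¬meets (x , n , x∈A , refl)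

  ∉cl⇒exterior : ∀ A {x} → ¬ cl A x → x ∈ openSet (exterior A)
  ∉cl⇒exterior A {x} x∉cl = n , cong not (dec-false em ¬meets)
    where
    isolated : ∃[ n ] ¬ (∃[ y ] y ∈ ⟦ A ⟧ × AgreeBelow n x y)
    isolated = dne (x∉cl ∘ ¬∃¬⇒∀)

    n : ℕ
    n = proj₁ isolated

    ¬meets : ¬ Meets A (prefix x n)
    ¬meets (y , m , y∈A , eq) =
      proj₂ isolated (y , y∈A , proj₂ (prefix-injective n m (sym eq)))

  exterior-dense : ∀ A → NowhereDense A → Dense (openSet (exterior A))
  exterior-dense A = Dense-mono (∉cl⇒exterior A)

  ¬nowhereDense⇒interior : ∀ A → ¬ NowhereDense A →
    ∃₂ λ x n → ∀ y → AgreeBelow n x y → cl A y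
  ¬nowhereDense⇒interior A ¬nd = dne λ ∄ → ¬nd λ x n →
    dne λ ∄y → ∄ (x , n , λ y agree → dne λ y∉cl → ∄y (y , agree , y∉cl))

  -- A Luzin set under CH

  module Luzin (ch : ContinuumHypothesis) where
    private module CH = Bijection ch

    infix 4 _⋖_

    _⋖_ : Rel Cantor 0ℓ
    x ⋖ y = CH.to x ⊏ CH.to y

    ⋖-wellFounded : WellFounded _⋖_
    ⋖-wellFounded = On.wellFounded CH.to ⊏-wellFounded

    ⋖-respʳ : ∀ {x y z} → y ≗ z → x ⋖ y → x ⋖ z
    ⋖-respʳ {x} {y} {z} y≗z =
      ⊏-respʳ-≅ {CH.to x} {CH.to y} {CH.to z} (CH.cong y≗z)

    ⋖-connex : ∀ x y → x ⋖ y ⊎ x ≗ y ⊎ y ⋖ x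
    ⋖-connex x y with ⊏-connex (CH.to x) (CH.to y)
    ... | inj₁ lt        = inj₁ lt
    ... | inj₂ (inj₁ eq) = inj₂ (inj₁ (CH.injective eq))
    ... | inj₂ (inj₂ gt) = inj₂ (inj₂ gt)

    -- x is sent to the least bound of the embeddings of its ordinal into that of
    -- z: of two ordinals with the same least bound, neither is below the other.
    ⋖-enumerable : ∀ z → Enumerable (_⋖ z)
    ⋖-enumerable z = injection⇒enumerable
      (λ x p → to (proj₁ (rank x p))) (λ {x} {y} p q eq → same x y p q (injective eq))
      where
      module Z = CountableWellOrder (CH.to z)
      open Injection Z.countable

      rank : ∀ x → x ⋖ z → ∃ (Minimal Z._≺_ (EmbedsBelow (CH.to x) (CH.to z)))
      rank x p = minimal Z.wellFounded p

      rank-mono : ∀ x y (p : x ⋖ z) (q : y ⋖ z) → x ⋖ y →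
                  proj₁ (rank y q) Z.≈ proj₁ (rank x p) → ⊥
      rank-mono x y p q (_ , x↪y) eq =
        let _ , c≺ , x↪z = embedsBelow-trans {CH.to x} {CH.to y} {CH.to z}
                             x↪y (proj₁ (proj₂ (rank y q)))
        in proj₂ (proj₂ (rank x p)) x↪z (Z.<-respʳ-≈ eq c≺)

      same : ∀ x y (p : x ⋖ z) (q : y ⋖ z) →
             proj₁ (rank x p) Z.≈ proj₁ (rank y q) → x ≗ y
      same x y p q eq with ⋖-connex x y
      ... | inj₁ lt        = ⊥-elim (rank-mono x y p q lt (Z.Eq.sym eq))
      ... | inj₂ (inj₁ x≗y) = x≗y
      ... | inj₂ (inj₂ gt) = ⊥-elim (rank-mono y x q p gt eq)

    ¬⋗-enumerable : ∀ z → Enumerable (λ x → ¬ z ⋖ x)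
    ¬⋗-enumerable z = e , onto
      where
      e : ℕ → Cantor
      e zero    = z
      e (suc n) = proj₁ (⋖-enumerable z) n

      onto : ∀ x → ¬ z ⋖ x → ∃[ n ] e n ≗ x
      onto x z⋖̸x with ⋖-connex z x
      ... | inj₁ lt         = contradiction lt z⋖̸x
      ... | inj₂ (inj₁ z≗x) = 0 , z≗x
      ... | inj₂ (inj₂ gt)  = let n , eq = proj₂ (⋖-enumerable z) x gt in suc n , eq

    Generic : Cantor → Pred Cantor 0ℓ
    Generic α x = ∀ β → β ⋖ α → denseOpenSet β x

    generic-cong : ∀ {α α′} → α ≗ α′ → Generic α ⊆ Generic α′
    generic-cong {α} {α′} α≗α′ gen β β⋖α′ = gen β (⋖-respʳ {β} {α′} {α} (≗-sym α≗α′) β⋖α′)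

    generic-respects : ∀ α {x y} → x ≗ y → Generic α x → Generic α y
    generic-respects α x≗y gen β β⋖α =
      proj₂ (denseOpenSet-open β (gen β β⋖α)) _ (λ i _ → x≗y i)

    generic-nonempty : ∀ α → ∃ (Generic α)
    generic-nonempty α =
      let e , onto = ⋖-enumerable α
          -- `e` may also list points that are not below `α`; this is harmless, since every code
          -- gives a dense open set.
          x , x∈   = baire (denseOpenSet ∘ e) (denseOpenSet-open ∘ e) (denseOpenSet-dense ∘ e)
      in x , λ β β⋖α → let n , eₙ≗β = onto β β⋖α in denseOpenSet-cong eₙ≗β (x∈ n)

    -- Choosing the least generic point makes the choice depend on α up to ≗ only.
    LeastGeneric : Cantor → Pred Cantor 0ℓ
    LeastGeneric α = Minimal _⋖_ (Generic α)

    leastGeneric : ∀ α → ∃ (LeastGeneric α)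
    leastGeneric α = minimal ⋖-wellFounded (generic-nonempty α)

    leastGeneric-unique : ∀ α α′ {x y} → α ≗ α′ → LeastGeneric α x → LeastGeneric α′ y → x ≗ y
    leastGeneric-unique α α′ {x} {y} α≗α′ (gen , min) (gen′ , min′) with ⋖-connex x y
    ... | inj₁ lt         = contradiction lt (min′ (generic-cong {α} {α′} α≗α′ gen))
    ... | inj₂ (inj₁ x≗y) = x≗y
    ... | inj₂ (inj₂ gt)  = contradiction gt (min (generic-cong {α′} {α} (≗-sym α≗α′) gen′))

    luzin : Subset
    luzin = record
      { ⟦_⟧      = λ y → ∃[ α ] LeastGeneric α y
      ; respects = λ {x} {y} x≗y (α , gen , min) →
          α , generic-respects α x≗y gen ,
          λ {w} gen′ w⋖y → min gen′ (⋖-respʳ {w} {y} {x} (≗-sym x≗y) w⋖y)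
      }

    -- If `z ⋖ α`, the point chosen for `α` lies in `openSet z`. So a point outside comes from one
    -- of the countably many other `α`, which determines it.
    luzin∖dense-enumerable : ∀ z → Dense (openSet z) →
      Enumerable (λ y → y ∈ ⟦ luzin ⟧ × y ∉ openSet z)
    luzin∖dense-enumerable z dense =
      proj₁ ∘ leastGeneric ∘ e , onto
      where
      e : ℕ → Cantor
      e = proj₁ (¬⋗-enumerable z)

      onto : ∀ y → y ∈ ⟦ luzin ⟧ × y ∉ openSet z → ∃[ n ] proj₁ (leastGeneric (e n)) ≗ y
      onto y ((α , least) , y∉) =
        let n , eₙ≗α = proj₂ (¬⋗-enumerable z) α (λ z⋖α → y∉ (proj₁ least z z⋖α dense))
        in n , leastGeneric-unique (e n) α eₙ≗α (proj₂ (leastGeneric (e n))) least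

    -- Given an enumeration, the point chosen for `α` is its `n`-th for some `n`, so the code of the
    -- complement of that singleton cannot precede `α`. Then countably many countable sets would
    -- cover the Cantor space.
    luzin-uncountable : Uncountable luzin
    luzin-uncountable countable = ¬enumerable-U (proj₁ union , λ α _ → proj₂ union α (bounded α))
      where
      enum : Enumerable ⟦ luzin ⟧
      enum = countable⇒enumerable luzin countable

      point : ℕ → Subset
      point n = singleton (proj₁ enum n)

      union : Enumerable (λ α → ∃[ n ] ¬ exterior (point n) ⋖ α)
      union = ⋃-enumerable (λ n → ¬⋗-enumerable (exterior (point n)))

      bounded : ∀ α → ∃[ n ] ¬ exterior (point n) ⋖ α
      bounded α =
        let y , least = leastGeneric α
            n , eₙ≗y  = proj₂ enum y (α , least)
        in n , λ lt → exterior-disjoint (point n) eₙ≗y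
             (proj₁ least _ lt (exterior-dense (point n) (singleton-nowhereDense _)))

    -- Otherwise the exterior of `A` is dense and misses `A`, which leaves only countably many
    -- points of the Luzin set for `A`.
    ⊆luzin-¬nowhereDense : ∀ A → ⟦ A ⟧ ⊆ ⟦ luzin ⟧ → Uncountable A → ¬ NowhereDense A
    ⊆luzin-¬nowhereDense A A⊆ uncountable nd =
      let e , onto = luzin∖dense-enumerable (exterior A) (exterior-dense A nd)
      in uncountable (enumerable⇒countable A
           (e , λ x x∈A → onto x (A⊆ x∈A , exterior-disjoint A x∈A)))

    -- Each closure contains a cylinder, and disjointness makes the code of this cylinder an
    -- injection of the Cantor space into the natural numbers.
    luzin-¬disjoint-closures : (Z : CountableWellOrder → Subset) →
      (∀ α → ⟦ Z α ⟧ ⊆ ⟦ luzin ⟧ × Uncountable (Z α)) →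
      ¬ (∀ α β → ¬ α ≅ β → Empty (cl (Z α) ∩ cl (Z β)))
    luzin-¬disjoint-closures Z large disjoint =
      ¬enumerable-U (injection⇒enumerable (λ α _ → code α) (λ {α} {β} _ _ → code-injective α β))
      where
      interior : ∀ α → ∃₂ λ x n → ∀ y → AgreeBelow n x y → cl (Z (CH.to α)) y
      interior α = ¬nowhereDense⇒interior (Z (CH.to α))
        (⊆luzin-¬nowhereDense (Z (CH.to α)) (proj₁ (large (CH.to α))) (proj₂ (large (CH.to α))))

      centre : Cantor → Cantor
      centre = proj₁ ∘ interior

      radius : Cantor → ℕ
      radius = proj₁ ∘ proj₂ ∘ interior

      ball⊆cl : ∀ α y → AgreeBelow (radius α) (centre α) y → cl (Z (CH.to α)) y
      ball⊆cl = proj₂ ∘ proj₂ ∘ interior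

      code : Cantor → ℕ
      code α = prefix (centre α) (radius α)

      code-injective : ∀ α β → code α ≡ code β → α ≗ β
      -- Equal codes mean equal cylinders, so `centre β` lies in both closures.
      code-injective α β eq = CH.injective {α} {β} (dne λ α≇β →
        disjoint (CH.to α) (CH.to β) α≇β (centre β)
          ( ball⊆cl α (centre β)
              (proj₂ (prefix-injective (radius α) (radius β) {centre α} {centre β} eq))
          , ball⊆cl β (centre β) (λ _ _ → refl)))

proposition12 : ExcludedMiddle 0ℓ → ContinuumHypothesis → ¬ Grinzing full
proposition12 em ch (_ , grinzing) =
  let Z , _ , large , disjoint = grinzing luzin (λ _ → tt) luzin-uncountable
  in luzin-¬disjoint-closures Z large disjoint
  where
  open Classical em
  open Luzin ch
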